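{- Let $q\geq 3$ be a prime power and let $A(q)=(X,\mathcal{B})$ be an affine plane of order $q$. Let $\mathcal{C}_A(q)$ be the combinatorial batch code whose servers are the $q^2$ points of $A(q)$ and whose items are the $q(q+1)$ blocks of $A(q)$, where an item (block) is stored in exactly those servers that are the points it contains; it is a $q$-uniform $(q^2+q,\,q^3+q^2,\,q^2,\,q^2)$-CBC. Then $\mathcal{C}_A(q)$ is an optimal $q$-uniform CBC attaining the upper bound $$n(m,c,k)\leq \frac{(k-1)\binom{m}{c}}{\binom{k-1}{c}}$$ with $m=k=q^2$ and $c=q$; that is, its number of items $n=q^2+q$ equals $n(q^2,q,q^2)$ and equals the right-hand side of this bound.
   Context: An $(n,N,k,m)$-CBC (combinatorial batch code) consists of a set $\mathcal{S}$ of $m$ servers and $n$ items $x_1,\dots,x_n$, where item $x_j$ is stored in the servers of a subset $X_j\subseteq\mathcal{S}$, with total storage $\sum_{j=1}^n|X_j|=N$, such that any $k$ items can be retrieved by reading at most one item from each server; that is, for any $k$ distinct indices $i_1,\dots,i_k$ there exist pairwise distinct servers $s_1,\dots,s_k$ with $s_j\in X_{i_j}$ for all $j$. It is $c$-uniform if $|X_j|=c$ for every $j$ (so $N=cn$). $n(m,c,k)$ denotes the maximum $n$ for which a $c$-uniform $(n,cn,k,m)$-CBC exists; a $c$-uniform $(n,cn,k,m)$-CBC is optimal if $n=n(m,c,k)$. The displayed upper bound on $n(m,c,k)$ is a known result from earlier literature. An affine plane of order $s$ is a set system $(X,\mathcal{B})$ where $|X|=s^2$, $\mathcal{B}$ is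 a collection of $s(s+1)$ subsets (blocks) of $X$, each of size $s$, such that each pair of points of $X$ occurs together in exactly one block. -}

module Defs where

open import Algebra.Properties.CommutativeMonoid.Sum using (sum)
open import Data.Fin using (Fin)
open import Data.Fin.Subset using (Subset; _∈_; ∣_∣)
open import Data.Integer using (+_)
open import Data.Nat using (ℕ; suc; _+_; _*_; _∸_; _^_; _≤_; _<_; z≤n; s≤s; >-nonZero)
open import Data.Nat.Combinatorics using (_C_; nCn≡1; nCk≡nC[n∸k]; nCk+nC[k+1]≡[n+1]C[k+1])
open import Data.Nat.Primality using (Prime)
open import Data.Nat.Properties
open import Data.Product using (∃; ∃₂; ∃!; _×_)
open import Data.Rational using (ℚ; _/_)
open import Function.Definitions using (Injective)
open import Relation.Binary.PropositionalEquality using (_≡_; _≢_; sym; trans; cong; subst)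

PrimePower : ℕ → Set
PrimePower q = ∃₂ λ p a → Prime p × 1 ≤ a × q ≡ p ^ a

-- A placement of items on the m servers Fin m; distinct items may have the
-- same server set.
record Placement (m : ℕ) : Set where
  field
    items : ℕ
    store : Fin items → Subset m

open Placement public

totalStorage : ∀ {m} → Placement m → ℕ
totalStorage 𝒞 = sum +-0-commutativeMonoid λ j → ∣ store 𝒞 j ∣

-- The k distinct requested indices are an injection i, and the k distinct
-- servers from which they are read are an injection s.
Retrievable : ∀ {m} → ℕ → Placement m → Set
Retrievable {m} k 𝒞 =
  (i : Fin k → Fin (items 𝒞)) → Injective _≡_ _≡_ i →
  ∃ λ (s : Fin k → Fin m) → Injective _≡_ _≡_ s × (∀ j → s j ∈ store 𝒞 (i j))

record IsCBC (n N k m : ℕ) (𝒞 : Placement m) : Set where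
  field
    numItems  : items 𝒞 ≡ n
    storage   : totalStorage 𝒞 ≡ N
    retrieval : Retrievable k 𝒞

Uniform : ∀ {m} → ℕ → Placement m → Set
Uniform c 𝒞 = ∀ j → ∣ store 𝒞 j ∣ ≡ c

UniformCBC : (c n k m : ℕ) → Placement m → Set
UniformCBC c n k m 𝒞 = IsCBC n (c * n) k m 𝒞 × Uniform c 𝒞

-- "n = n(m,c,k)".  This is a relation because the maximum need not exist for
-- every m, c and k (for instance when c ≥ k and m ≥ c).
IsMaxItems : (m c k n : ℕ) → Set
IsMaxItems m c k n =
  ∃ (UniformCBC c n k m) × (∀ n′ → ∃ (UniformCBC c n′ k m) → n′ ≤ n)

Optimal : ∀ {m} → (c k : ℕ) → Placement m → Set
Optimal {m} c k 𝒞 = UniformCBC c (items 𝒞) k m 𝒞 × IsMaxItems m c k (items 𝒞)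

nCk>0 : ∀ {n k} → k ≤ n → 0 < n C k
nCk>0 {n} z≤n =
  subst (0 <_) (sym (trans (nCk≡nC[n∸k] {0} {n} z≤n) (nCn≡1 n))) (s≤s z≤n)
nCk>0 {suc n} {suc k} (s≤s k≤n) =
  subst (0 <_) (nCk+nC[k+1]≡[n+1]C[k+1] n k) (≤-trans (nCk>0 k≤n) (m≤m+n _ _))

upperBound : (m c k : ℕ) → .(c ≤ k ∸ 1) → ℚ
upperBound m c k c≤k-1 = _/_ (+ ((k ∸ 1) * (m C c))) ((k ∸ 1) C c) {{>-nonZero (nCk>0 c≤k-1)}}

3≤q⇒q≤q²-1 : ∀ {q} → 3 ≤ q → q ≤ q ^ 2 ∸ 1
3≤q⇒q≤q²-1 {q} 3≤q = begin
  q          ≡⟨ m+n∸n≡m q 1 ⟨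
  q + 1 ∸ 1  ≤⟨ ∸-monoˡ-≤ 1 q+1≤q² ⟩
  q ^ 2 ∸ 1  ∎
  where
  open ≤-Reasoning
  q+1≤q² : q + 1 ≤ q ^ 2
  q+1≤q² = begin
    q + 1        ≤⟨ +-monoʳ-≤ q (≤-trans (s≤s z≤n) 3≤q) ⟩
    q + q        ≡⟨ cong (λ r → q + r) (+-identityʳ q) ⟨
    2 * q        ≤⟨ *-monoˡ-≤ q (≤-trans (s≤s (s≤s z≤n)) 3≤q) ⟩
    q * q        ≡⟨ cong (q *_) (*-identityʳ q) ⟨
    q ^ 2        ∎

-- Blocks form a set, hence the injectivity of their indexing.
record AffinePlane (s : ℕ) : Set where
  field
    block     : Fin (s * (s + 1)) → Subset (s ^ 2)
    distinct  : Injective _≡_ _≡_ block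
    blockSize : ∀ b → ∣ block b ∣ ≡ s
    joined    : ∀ {x y} → x ≢ y → ∃! _≡_ λ b → x ∈ block b × y ∈ block b

affineCode : ∀ {q} → AffinePlane q → Placement (q ^ 2)
affineCode {q} A = record
  { items = q * (q + 1)
  ; store = AffinePlane.block A
  }

{-# OPTIONS --safe #-}

-- Retrieval is Hall's theorem. Suppose the chosen blocks J lie in U. If U is
-- everything, |J| ≤ q² = |U|. Otherwise pick x ∉ U: through each p ∈ U go q + 1
-- lines, of which the one through x is not in J, so counting incidences gives
-- q |J| ≤ q |U|.
--
-- For optimality, at most m − 1 items of a code with k = m avoid a given server,
-- since any m items need m distinct servers. Counting the pairs (server, item
-- avoiding it) gives n (m − c) ≤ m (m − 1), with equality for the affine code.

module Submission where

open import Defs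
import Algebra.Properties.Semiring.Sum
open import Data.Empty using (⊥-elim)
open import Data.Fin using (Fin; zero; suc; _≟_)
open import Data.Fin.Properties using (any?; all?; 0≢1+n; suc-injective; punchOut-injective; injective⇒≤)
open import Data.Fin.Subset using (Subset; _∈_; _∉_; _⊆_; _∪_; _∩_; _-_; ∁; ⁅_⁆; ⊤; ⊥; ∣_∣; inside; outside)
open import Data.Fin.Subset.Properties
open import Data.Integer.Properties using (pos-*)
open import Data.Nat using (ℕ; zero; suc; _+_; _*_; _∸_; _≤_; _<_; _^_; _!; _<?_; z≤n; s≤s; NonZero; >-nonZero)
open import Data.Nat.Combinatorics using (_C_; nCk≡n!/k![n-k]!; k![n∸k]!∣n!; [n-k]*[n-k-1]!≡[n-k]!)
open import Data.Nat.DivMod using (m/n*n≡m)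
open import Data.Nat.Induction using (Acc; acc; <-wellFounded)
open import Data.Nat.Properties hiding (_≟_; 0≢1+n; suc-injective)
open import Data.Nat.Tactic.RingSolver using (solve-∀)
open import Data.Product using (∃; ∃₂; _×_; _,_; proj₁; proj₂)
open import Data.Rational using (_/_)
open import Data.Rational.Properties using (fromℚᵘ-cong)
open import Data.Rational.Unnormalised using (mkℚᵘ; *≡*)
open import Data.Sum using (_⊎_; inj₁; inj₂; map)
open import Data.Vec using ([]; _∷_; there)
open import Data.Vec.Functional using (updateAt)
open import Data.Vec.Functional.Properties using (updateAt-updates; updateAt-minimal)
open import Function using (_∘_)
open import Function.Definitions using (Injective)
open import Relation.Binary.PropositionalEquality
open import Relation.Nullary using (¬_; Dec; yes; no; contradiction; ¬?; _×-dec_; _→-dec_)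
open import Relation.Nullary.Decidable using (decidable-stable)

open Algebra.Properties.Semiring.Sum +-*-semiring
  using (sum; sum-syntax; sum-cong-≗; ∑-distrib-+; ∑-comm; *-distribʳ-sum)

private
  variable
    m n : ℕ

-- Iverson brackets and finite sums

𝟙 : {P : Set} → Dec P → ℕ
𝟙 (yes _) = 1
𝟙 (no  _) = 0

𝟙-mono : {P Q : Set} (P? : Dec P) (Q? : Dec Q) → (P → Q) → 𝟙 P? ≤ 𝟙 Q?
𝟙-mono (no  _) _       _   = z≤n
𝟙-mono (yes _) (yes _) _   = ≤-refl
𝟙-mono (yes p) (no ¬q) P→Q = contradiction (P→Q p) ¬q

𝟙-cong : {P Q : Set} (P? : Dec P) (Q? : Dec Q) → (P → Q) → (Q → P) → 𝟙 P? ≡ 𝟙 Q?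
𝟙-cong P? Q? P→Q Q→P = ≤-antisym (𝟙-mono P? Q? P→Q) (𝟙-mono Q? P? Q→P)

𝟙-false : {P : Set} (P? : Dec P) → ¬ P → 𝟙 P? ≡ 0
𝟙-false (no  _) _  = refl
𝟙-false (yes p) ¬p = contradiction p ¬p

∑-mono : {f g : Fin n → ℕ} → (∀ i → f i ≤ g i) → sum f ≤ sum g
∑-mono {zero}  _   = z≤n
∑-mono {suc n} f≤g = +-mono-≤ (f≤g zero) (∑-mono (f≤g ∘ suc))

∑-strictMono : {f g : Fin n → ℕ} → (∀ i → f i ≤ g i) → ∀ i → f i < g i → sum f < sum g
∑-strictMono {suc n} f≤g zero    fi<gi = +-mono-<-≤ fi<gi (∑-mono (f≤g ∘ suc))
∑-strictMono {suc n} f≤g (suc i) fi<gi = +-mono-≤-< (f≤g zero) (∑-strictMono (f≤g ∘ suc) i fi<gi)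

∑-const : ∀ n c → ∑[ i < n ] c ≡ n * c
∑-const zero    c = refl
∑-const (suc n) c = cong (λ s → c + s) (∑-const n c)

∑-zero : {f : Fin n → ℕ} → (∀ i → f i ≡ 0) → sum f ≡ 0
∑-zero {n} f≡0 = trans (sum-cong-≗ f≡0) (trans (∑-const n 0) (*-zeroʳ n))

∑-𝟙≤1 : {P : Fin n → Set} (P? : ∀ i → Dec (P i)) → (∀ {i j} → P i → P j → i ≡ j) →
        ∑[ i < n ] 𝟙 (P? i) ≤ 1
∑-𝟙≤1 {zero}  P? unique = z≤n
∑-𝟙≤1 {suc n} P? unique with P? zero
... | no  _  = ∑-𝟙≤1 (P? ∘ suc) λ p p′ → suc-injective (unique p p′)
... | yes p₀ = ≤-reflexive (cong suc (∑-zero λ i → 𝟙-false (P? (suc i)) λ pᵢ → 0≢1+n (unique p₀ pᵢ)))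

-- Cardinalities as sums, and double counting

∣p∣≡∑𝟙 : (p : Subset n) → ∣ p ∣ ≡ ∑[ x < n ] 𝟙 (x ∈? p)
∣p∣≡∑𝟙 []            = refl
∣p∣≡∑𝟙 (inside  ∷ p) = cong suc (trans (∣p∣≡∑𝟙 p)
  (sum-cong-≗ λ x → 𝟙-cong (x ∈? p) (suc x ∈? (inside ∷ p)) there drop-there))
∣p∣≡∑𝟙 (outside ∷ p) = trans (∣p∣≡∑𝟙 p)
  (sum-cong-≗ λ x → 𝟙-cong (x ∈? p) (suc x ∈? (outside ∷ p)) there drop-there)

∑-𝟙×∈ : {P : Set} (P? : Dec P) (p : Subset n) → ∑[ x < n ] 𝟙 (P? ×-dec x ∈? p) ≡ 𝟙 P? * ∣ p ∣
∑-𝟙×∈ (no ¬P) p = ∑-zero λ x → 𝟙-false (no ¬P ×-dec x ∈? p) (¬P ∘ proj₁)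
∑-𝟙×∈ (yes P) p = trans
  (sum-cong-≗ λ x → 𝟙-cong (yes P ×-dec x ∈? p) (x ∈? p) proj₂ (P ,_))
  (trans (sym (∣p∣≡∑𝟙 p)) (sym (+-identityʳ _)))

-- Both sides count the incidences of a point with an index satisfying `P`. The filter serves two
-- uses: counting all chosen blocks, and only those through a fixed point.
doubleCount : {P : Fin n → Set} (P? : ∀ j → Dec (P j)) (B : Fin n → Subset m) →
  ∀ {c} → (∀ j → ∣ B j ∣ ≡ c) →
  (∑[ j < n ] 𝟙 (P? j)) * c ≡ ∑[ x < m ] ∑[ j < n ] 𝟙 (P? j ×-dec x ∈? B j)
doubleCount {n} {m} P? B {c} ∣B∣≡c = begin
  (∑[ j < n ] 𝟙 (P? j)) * c                          ≡⟨ *-distribʳ-sum c (λ j → 𝟙 (P? j)) ⟩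
  ∑[ j < n ] (𝟙 (P? j) * c)                          ≡⟨ sum-cong-≗ (λ j → cong (𝟙 (P? j) *_) (∣B∣≡c j)) ⟨
  ∑[ j < n ] (𝟙 (P? j) * ∣ B j ∣)                    ≡⟨ sum-cong-≗ (λ j → ∑-𝟙×∈ (P? j) (B j)) ⟨
  ∑[ j < n ] ∑[ x < m ] 𝟙 (P? j ×-dec x ∈? B j)      ≡⟨ ∑-comm (λ j x → 𝟙 (P? j ×-dec x ∈? B j)) ⟩
  ∑[ x < m ] ∑[ j < n ] 𝟙 (P? j ×-dec x ∈? B j)      ∎
  where open ≡-Reasoning

-- Turns a large count into a request: it supplies the distinct items that all avoid one server in
-- `avoiding<m`.
select : {P : Fin n → Set} (P? : ∀ i → Dec (P i)) → ∀ {k} → k ≤ ∑[ i < n ] 𝟙 (P? i) →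
         ∃ λ (f : Fin k → Fin n) → Injective _≡_ _≡_ f × (∀ j → P (f j))
select {zero} P? {zero} _ = (λ ()) , (λ { {()} }) , λ ()
select {suc n} P? {zero} _ = (λ ()) , (λ { {()} }) , λ ()
select {suc n} P? {suc k} k≤∑ with P? zero
... | no _ =
  let f , f-inj , Pf = select (P? ∘ suc) k≤∑
  in suc ∘ f , f-inj ∘ suc-injective , Pf
... | yes p₀ with select (P? ∘ suc) (≤-pred k≤∑)
...   | f , f-inj , Pf = g , (λ {i} {j} → g-inj i j) , Pg
  where
  g : Fin (suc k) → Fin (suc n)
  g zero    = zero
  g (suc i) = suc (f i)
  g-inj : ∀ i j → g i ≡ g j → i ≡ j
  g-inj zero    zero    _  = refl
  g-inj (suc i) (suc j) eq = cong suc (f-inj (suc-injective eq))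
  Pg : ∀ j → _
  Pg zero    = p₀
  Pg (suc j) = Pf j

-- Hall's theorem

∣p∪q∣+∣p∩q∣≡∣p∣+∣q∣ : (p q : Subset n) → ∣ p ∪ q ∣ + ∣ p ∩ q ∣ ≡ ∣ p ∣ + ∣ q ∣
∣p∪q∣+∣p∩q∣≡∣p∣+∣q∣ []            []            = refl
∣p∪q∣+∣p∩q∣≡∣p∣+∣q∣ (outside ∷ p) (outside ∷ q) = ∣p∪q∣+∣p∩q∣≡∣p∣+∣q∣ p q
∣p∪q∣+∣p∩q∣≡∣p∣+∣q∣ (inside  ∷ p) (outside ∷ q) = cong suc (∣p∪q∣+∣p∩q∣≡∣p∣+∣q∣ p q)
∣p∪q∣+∣p∩q∣≡∣p∣+∣q∣ (outside ∷ p) (inside  ∷ q) =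
  trans (cong suc (∣p∪q∣+∣p∩q∣≡∣p∣+∣q∣ p q)) (sym (+-suc ∣ p ∣ ∣ q ∣))
∣p∪q∣+∣p∩q∣≡∣p∣+∣q∣ (inside  ∷ p) (inside  ∷ q) =
  cong suc (trans (+-suc _ _) (trans (cong suc (∣p∪q∣+∣p∩q∣≡∣p∣+∣q∣ p q)) (sym (+-suc ∣ p ∣ ∣ q ∣))))

∣p∣≤1+∣p∩∁⁅x⁆∣ : (p : Subset n) (x : Fin n) → ∣ p ∣ ≤ suc ∣ p ∩ ∁ ⁅ x ⁆ ∣
∣p∣≤1+∣p∩∁⁅x⁆∣ p x = begin
  ∣ p ∣                        ≤⟨ p⊆q⇒∣p∣≤∣q∣ p⊆ ⟩
  ∣ ⁅ x ⁆ ∪ p′ ∣               ≤⟨ m≤m+n _ _ ⟩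
  ∣ ⁅ x ⁆ ∪ p′ ∣ + ∣ ⁅ x ⁆ ∩ p′ ∣  ≡⟨ ∣p∪q∣+∣p∩q∣≡∣p∣+∣q∣ ⁅ x ⁆ p′ ⟩
  ∣ ⁅ x ⁆ ∣ + ∣ p′ ∣           ≡⟨ cong (_+ ∣ p′ ∣) (∣⁅x⁆∣≡1 x) ⟩
  suc ∣ p′ ∣                   ∎
  where
  open ≤-Reasoning
  p′ : Subset _
  p′ = p ∩ ∁ ⁅ x ⁆
  p⊆ : p ⊆ ⁅ x ⁆ ∪ p′
  p⊆ {y} y∈p with y ∈? ⁅ x ⁆
  ... | yes y∈⁅x⁆ = x∈p∪q⁺ (inj₁ y∈⁅x⁆)
  ... | no  y∉⁅x⁆ = x∈p∪q⁺ (inj₂ (x∈p∩q⁺ (y∈p , x∉p⇒x∈∁p y∉⁅x⁆)))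

-- U stands for any superset of the neighbourhood of J.
HallCondition : (Fin n → Subset m) → Set
HallCondition {n} {m} G =
  (J : Subset n) (U : Subset m) → (∀ j → j ∈ J → G j ⊆ U) → ∣ J ∣ ≤ ∣ U ∣

Violation : (Fin n → Subset m) → Set
Violation {n} {m} G =
  ∃ λ (J : Subset n) → ∃ λ (U : Subset m) → (∀ j → j ∈ J → G j ⊆ U) × ∣ U ∣ < ∣ J ∣

-- `J` and `U` range over finitely many subsets, so exhaustive search decides this and makes the
-- case split in `delete-hall` constructive.
violation? : (G : Fin n → Subset m) → Dec (Violation G)
violation? G = anySubset? λ J → anySubset? λ U →
  all? (λ j → j ∈? J →-dec G j ⊆? U) ×-dec (∣ U ∣ <? ∣ J ∣)

¬Violation⇒HallCondition : (G : Fin n → Subset m) → ¬ Violation G → HallCondition G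
¬Violation⇒HallCondition G ¬v J U N⊆U = ≮⇒≥ λ U<J → ¬v (J , U , N⊆U , U<J)

delete : (Fin n → Subset m) → Fin n → Fin m → Fin n → Subset m
delete G j x = updateAt G j (_- x)

delete-⊆ : (G : Fin n → Subset m) (j : Fin n) (x : Fin m) → ∀ i → delete G j x i ⊆ G i
delete-⊆ G j x i {z} z∈ with i ≟ j
... | yes refl = p─q⊆p (G i) ⁅ x ⁆ (subst (z ∈_) (updateAt-updates i G) z∈)
... | no  i≢j  = subst (z ∈_) (updateAt-minimal i j G i≢j) z∈

-- If `j ∉ J`, the deletion changes no set indexed by `J`, and `hall` excludes the violation. So
-- `j ∈ J`, and in terms of `G` only the element `x` of `G j` can lie outside `U`.
delete-violation : {G : Fin n → Subset m} {j : Fin n} {x : Fin m} →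
  HallCondition G → Violation (delete G j x) →
  ∃₂ λ J U → j ∈ J × (∀ i → i ∈ J → i ≢ j → G i ⊆ U) ×
             (∀ {z} → z ∈ G j → z ≢ x → z ∈ U) × ∣ U ∣ < ∣ J ∣
delete-violation {G = G} {j} {x} hall (J , U , N⊆U , U<J) with j ∈? J
... | yes j∈J = J , U , j∈J , N⊆U′ ,
  (λ {z} z∈Gj z≢x → N⊆U j j∈J (subst (z ∈_) (sym (updateAt-updates j G)) (x∈p∧x≢y⇒x∈p-y z∈Gj z≢x))) ,
  U<J
  where
  N⊆U′ : ∀ i → i ∈ J → i ≢ j → G i ⊆ U
  N⊆U′ i i∈J i≢j {z} z∈Gi = N⊆U i i∈J (subst (z ∈_) (sym (updateAt-minimal i j G i≢j)) z∈Gi)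
... | no  j∉J = contradiction (hall J U N⊆U′) (<⇒≱ U<J)
  where
  N⊆U′ : ∀ i → i ∈ J → G i ⊆ U
  N⊆U′ i i∈J {z} z∈Gi = N⊆U i i∈J
    (subst (z ∈_) (sym (updateAt-minimal i j G λ { refl → j∉J i∈J })) z∈Gi)

-- Rado's deletion step: if both deletions violated Hall's condition, with
-- (J₁ , U₁) and (J₂ , U₂), then the condition for J₁ ∪ J₂ and for
-- J₁ ∩ J₂ without j would contradict the modularity of cardinality.
¬delete-violations : {G : Fin n → Subset m} {j : Fin n} {x y : Fin m} →
  HallCondition G → x ≢ y → Violation (delete G j x) → ¬ Violation (delete G j y)
¬delete-violations {G = G} {j} {x} {y} hall x≢y v₁ v₂
  with delete-violation hall v₁ | delete-violation hall v₂
... | J₁ , U₁ , j∈J₁ , N₁ , Nj₁ , U₁<J₁ | J₂ , U₂ , j∈J₂ , N₂ , Nj₂ , U₂<J₂ =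
  n≮n (suc (∣ U₁ ∣ + ∣ U₂ ∣)) (begin-strict
    suc (∣ U₁ ∣ + ∣ U₂ ∣)                  <⟨ s≤s (≤-reflexive (sym (+-suc ∣ U₁ ∣ ∣ U₂ ∣))) ⟩
    suc ∣ U₁ ∣ + suc ∣ U₂ ∣                ≤⟨ +-mono-≤ U₁<J₁ U₂<J₂ ⟩
    ∣ J₁ ∣ + ∣ J₂ ∣                        ≡⟨ ∣p∪q∣+∣p∩q∣≡∣p∣+∣q∣ J₁ J₂ ⟨
    -- Dropping `j` from the intersection costs one, whereas the two violations together gained two.
    ∣ J₁ ∪ J₂ ∣ + ∣ J₁ ∩ J₂ ∣              ≤⟨ +-monoʳ-≤ ∣ J₁ ∪ J₂ ∣ (∣p∣≤1+∣p∩∁⁅x⁆∣ (J₁ ∩ J₂) j) ⟩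
    ∣ J₁ ∪ J₂ ∣ + suc ∣ (J₁ ∩ J₂) ∩ ∁ ⁅ j ⁆ ∣       ≤⟨ +-mono-≤ (hall (J₁ ∪ J₂) (U₁ ∪ U₂) N∪) (s≤s (hall _ (U₁ ∩ U₂) N∩)) ⟩
    ∣ U₁ ∪ U₂ ∣ + suc ∣ U₁ ∩ U₂ ∣          ≡⟨ +-suc _ _ ⟩
    suc (∣ U₁ ∪ U₂ ∣ + ∣ U₁ ∩ U₂ ∣)        ≡⟨ cong suc (∣p∪q∣+∣p∩q∣≡∣p∣+∣q∣ U₁ U₂) ⟩
    suc (∣ U₁ ∣ + ∣ U₂ ∣)                  ∎)
  where
  open ≤-Reasoning
  N∪ : ∀ i → i ∈ J₁ ∪ J₂ → G i ⊆ U₁ ∪ U₂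
  N∪ i i∈J₁∪J₂ {z} z∈Gi with i ≟ j
  ... | no i≢j = x∈p∪q⁺ (map (λ i∈J₁ → N₁ i i∈J₁ i≢j z∈Gi) (λ i∈J₂ → N₂ i i∈J₂ i≢j z∈Gi)
                             (x∈p∪q⁻ J₁ J₂ i∈J₁∪J₂))
  ... | yes refl with z ≟ x
  ...   | no  z≢x  = x∈p∪q⁺ (inj₁ (Nj₁ z∈Gi z≢x))
  -- The element `x` missing from the first family is covered by `U₂`, because the second family
  -- lost only `y`.
  ...   | yes refl = x∈p∪q⁺ (inj₂ (Nj₂ z∈Gi x≢y))
  N∩ : ∀ i → i ∈ (J₁ ∩ J₂) ∩ ∁ ⁅ j ⁆ → G i ⊆ U₁ ∩ U₂
  N∩ i i∈ z∈Gi =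
    let i∈J₁∩J₂ , i∈∁⁅j⁆ = x∈p∩q⁻ (J₁ ∩ J₂) (∁ ⁅ j ⁆) i∈
        i∈J₁ , i∈J₂      = x∈p∩q⁻ J₁ J₂ i∈J₁∩J₂
        i≢j              = x∉⁅y⁆⇒x≢y (x∈∁p⇒x∉p i∈∁⁅j⁆)
    in x∈p∩q⁺ (N₁ i i∈J₁ i≢j z∈Gi , N₂ i i∈J₂ i≢j z∈Gi)

delete-hall : {G : Fin n → Subset m} {j : Fin n} {x y : Fin m} → HallCondition G → x ≢ y →
  HallCondition (delete G j x) ⊎ HallCondition (delete G j y)
delete-hall {G = G} {j} {x} {y} hall x≢y with violation? (delete G j x)
... | no ¬v₁ = inj₁ (¬Violation⇒HallCondition _ ¬v₁)
... | yes v₁ = inj₂ (¬Violation⇒HallCondition _ (¬delete-violations hall x≢y v₁))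

-- The total size of the sets is the measure on which `hall-SDR` recurses.
∑∣delete∣<∑ : (G : Fin n → Subset m) {j : Fin n} {x : Fin m} → x ∈ G j →
  ∑[ i < n ] ∣ delete G j x i ∣ < ∑[ i < n ] ∣ G i ∣
∑∣delete∣<∑ G {j} {x} x∈Gj = ∑-strictMono
  (λ i → p⊆q⇒∣p∣≤∣q∣ (delete-⊆ G j x i)) j
  (subst (λ p → ∣ p ∣ < ∣ G j ∣) (sym (updateAt-updates j G)) (x∈p⇒∣p-x∣<∣p∣ x∈Gj))

SDR : (Fin n → Subset m) → Set
SDR {n} {m} G = ∃ λ (s : Fin n → Fin m) → Injective _≡_ _≡_ s × (∀ j → s j ∈ G j)

SDR-mono : {G H : Fin n → Subset m} → (∀ j → G j ⊆ H j) → SDR G → SDR H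
SDR-mono G⊆H (s , s-inj , s∈G) = s , s-inj , λ j → G⊆H j (s∈G j)

-- Hall's condition for a single index, with `U` empty, makes each set nonempty. For two indices
-- with the same representative, that singleton as `U` would be too small.
subsingletons-SDR : {G : Fin n → Subset m} → HallCondition G →
  (∀ {j x y} → x ∈ G j → y ∈ G j → x ≡ y) → SDR G
subsingletons-SDR {n} {m} {G} hall unique = proj₁ ∘ s , s-inj , proj₂ ∘ s
  where
  s : ∀ j → ∃ λ x → x ∈ G j
  s j with nonempty? (G j)
  ... | yes ne   = ne
  ... | no empty = contradiction
    (hall ⁅ j ⁆ ⊥ λ i i∈⁅j⁆ {x} x∈Gi → ⊥-elim (empty (x , subst (λ i → x ∈ G i) (x∈⁅y⁆⇒x≡y j i∈⁅j⁆) x∈Gi)))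
    (<⇒≱ (subst₂ _<_ (sym (∣⊥∣≡0 m)) (sym (∣⁅x⁆∣≡1 j)) (s≤s z≤n)))
  s-inj : Injective _≡_ _≡_ (proj₁ ∘ s)
  s-inj {i} {j} sᵢ≡sⱼ with i ≟ j
  ... | yes i≡j = i≡j
  ... | no  i≢j = contradiction (hall (⁅ i ⁆ ∪ ⁅ j ⁆) ⁅ proj₁ (s i) ⁆ N⊆)
    (<⇒≱ (subst (_< ∣ ⁅ i ⁆ ∪ ⁅ j ⁆ ∣) (trans (∣⁅x⁆∣≡1 i) (sym (∣⁅x⁆∣≡1 (proj₁ (s i)))))
      (p⊂q⇒∣p∣<∣q∣ (p⊆p∪q ⁅ j ⁆ , j , x∈p∪q⁺ (inj₂ (x∈⁅x⁆ j)) , x≢y⇒x∉⁅y⁆ (i≢j ∘ sym)))))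
    where
    N⊆ : ∀ l → l ∈ ⁅ i ⁆ ∪ ⁅ j ⁆ → G l ⊆ ⁅ proj₁ (s i) ⁆
    N⊆ l l∈ {x} x∈Gl with x∈p∪q⁻ ⁅ i ⁆ ⁅ j ⁆ l∈
    ... | inj₁ l∈⁅i⁆ with refl ← x∈⁅y⁆⇒x≡y i l∈⁅i⁆ =
      subst (λ y → x ∈ ⁅ y ⁆) (unique x∈Gl (proj₂ (s i))) (x∈⁅x⁆ x)
    ... | inj₂ l∈⁅j⁆ with refl ← x∈⁅y⁆⇒x≡y j l∈⁅j⁆ =
      subst (λ y → x ∈ ⁅ y ⁆) (trans (unique x∈Gl (proj₂ (s j))) (sym sᵢ≡sⱼ)) (x∈⁅x⁆ x)

-- As long as some set has two distinct elements, one of them can be deleted without losing Hall's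
-- condition. Representatives of the shrunken sets also represent the original ones.
hall-SDR : (G : Fin n → Subset m) → HallCondition G → SDR G
hall-SDR {n} {m} G = go G (<-wellFounded _)
  where
  go : (G : Fin n → Subset m) → Acc _<_ (∑[ j < n ] ∣ G j ∣) → HallCondition G → SDR G
  go G (acc rec) hall
    with any? (λ j → any? (λ x → any? (λ y → x ∈? G j ×-dec y ∈? G j ×-dec ¬? (x ≟ y))))
  ... | no ¬two = subsingletons-SDR hall λ {j} {x} {y} x∈Gj y∈Gj →
    decidable-stable (x ≟ y) λ x≢y → ¬two (j , x , y , x∈Gj , y∈Gj , x≢y)
  ... | yes (j , x , y , x∈Gj , y∈Gj , x≢y) with delete-hall {j = j} hall x≢y
  ...   | inj₁ hall′ = SDR-mono (delete-⊆ G j x) (go _ (rec (∑∣delete∣<∑ G x∈Gj)) hall′)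
  ...   | inj₂ hall′ = SDR-mono (delete-⊆ G j y) (go _ (rec (∑∣delete∣<∑ G y∈Gj)) hall′)

-- Retrieval from the affine code

module _ {q : ℕ} (A : AffinePlane q) where
  open AffinePlane A

  joined-unique : ∀ {x y b c} → x ≢ y → x ∈ block b → y ∈ block b → x ∈ block c → y ∈ block c → b ≡ c
  joined-unique x≢y x∈b y∈b x∈c y∈c =
    let _ , _ , unique = joined x≢y
    in trans (sym (unique (x∈b , y∈b))) (unique (x∈c , y∈c))

  module _ {k : ℕ} {i : Fin k → Fin (q * (q + 1))} (i-inj : Injective _≡_ _≡_ i) (J : Subset k) where

    chosenThrough : Fin (q ^ 2) → ℕ
    chosenThrough p = ∑[ j < k ] 𝟙 (j ∈? J ×-dec p ∈? block (i j))

    -- Let L be the line through p and x. No chosen block is L, so each of the r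
    -- chosen blocks through p has its other q − 1 points outside L, and these
    -- sets are disjoint: r (q − 1) ≤ q² − q.
    chosenThrough≤q : 2 ≤ q → ∀ {p x} → p ≢ x → (∀ j → j ∈ J → x ∉ block (i j)) → chosenThrough p ≤ q
    chosenThrough≤q (s≤s {n = q-1} 1≤q-1) {p} {x} p≢x x∉ =
      -- The count over all `y` includes `y = p`, which lies on all `r` blocks. This extra `r`
      -- appears on both sides and cancels, and then so does the factor `q - 1`.
      *-cancelʳ-≤ r q q-1 {{>-nonZero 1≤q-1}} (+-cancelʳ-≤ r (r * q-1) (q * q-1) (begin
        r * q-1 + r                            ≡⟨ +-comm (r * q-1) r ⟩
        r + r * q-1                            ≡⟨ *-suc r q-1 ⟨
        r * q                                  ≡⟨ doubleCount P? (block ∘ i) (blockSize ∘ i) ⟩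
        ∑[ y < q ^ 2 ] ∑[ j < k ] 𝟙 (Q? j y)   ≤⟨ ∑-mono bound ⟩
        ∑[ y < q ^ 2 ] (𝟙 (y ∈? ∁ (block L)) + 𝟙 (y ∈? ⁅ p ⁆) * r)
          ≡⟨ ∑-distrib-+ (λ y → 𝟙 (y ∈? ∁ (block L))) (λ y → 𝟙 (y ∈? ⁅ p ⁆) * r) ⟩
        ∑[ y < q ^ 2 ] 𝟙 (y ∈? ∁ (block L)) + ∑[ y < q ^ 2 ] (𝟙 (y ∈? ⁅ p ⁆) * r)
          ≡⟨ cong₂ _+_ (∣p∣≡∑𝟙 (∁ (block L))) (*-distribʳ-sum r (λ y → 𝟙 (y ∈? ⁅ p ⁆))) ⟨
        ∣ ∁ (block L) ∣ + (∑[ y < q ^ 2 ] 𝟙 (y ∈? ⁅ p ⁆)) * r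
          ≡⟨ cong₂ _+_ (∣∁p∣≡n∸∣p∣ (block L)) (cong (_* r) (sym (∣p∣≡∑𝟙 ⁅ p ⁆))) ⟩
        q ^ 2 ∸ ∣ block L ∣ + ∣ ⁅ p ⁆ ∣ * r
          ≡⟨ cong₂ _+_ (cong (q ^ 2 ∸_) (blockSize L)) (trans (cong (_* r) (∣⁅x⁆∣≡1 p)) (*-identityˡ r)) ⟩
        q ^ 2 ∸ q + r                          ≡⟨ cong (λ t → t ∸ q + r) (expand q-1) ⟩
        q * q-1 + q ∸ q + r                    ≡⟨ cong (_+ r) (m+n∸n≡m (q * q-1) q) ⟩
        q * q-1 + r                            ∎))
      where
      open ≤-Reasoning
      r : ℕ
      r = chosenThrough p
      -- The ring solver does not accept _^_; t * (t * 1) is definitionally t ^ 2.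
      expand : ∀ t → suc t * (suc t * 1) ≡ suc t * t + suc t
      expand = solve-∀
      P? : ∀ j → Dec (j ∈ J × p ∈ block (i j))
      P? j = j ∈? J ×-dec p ∈? block (i j)
      Q? : ∀ j y → Dec ((j ∈ J × p ∈ block (i j)) × y ∈ block (i j))
      Q? j y = P? j ×-dec y ∈? block (i j)
      L : Fin (q * (q + 1))
      L = proj₁ (joined p≢x)
      p∈L : p ∈ block L
      p∈L = proj₁ (proj₁ (proj₂ (joined p≢x)))
      x∈L : x ∈ block L
      x∈L = proj₂ (proj₁ (proj₂ (joined p≢x)))
      -- At `y = p` all `r` blocks may count. Off `L` at most one does, since two would share `p`
      -- and `y`. At any other point of `L` none does, since it would be `L` itself and contain `x`.
      bound : ∀ y → ∑[ j < k ] 𝟙 (Q? j y) ≤ 𝟙 (y ∈? ∁ (block L)) + 𝟙 (y ∈? ⁅ p ⁆) * r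
      bound y with y ∈? ⁅ p ⁆ | y ∈? ∁ (block L)
      ... | yes y∈⁅p⁆ | d = ≤-trans (∑-mono λ j → 𝟙-mono (Q? j y) (P? j) proj₁)
                              (≤-trans (≤-reflexive (sym (*-identityˡ r))) (m≤n+m (1 * r) (𝟙 d)))
      ... | no  y∉⁅p⁆ | yes _ = ≤-trans (∑-𝟙≤1 (λ j → Q? j y) λ ((_ , p∈b) , y∈b) ((_ , p∈c) , y∈c) →
                                i-inj (joined-unique (x∉⁅y⁆⇒x≢y y∉⁅p⁆) y∈b p∈b y∈c p∈c)) (m≤m+n 1 0)
      ... | no  y∉⁅p⁆ | no y∉∁L = ≤-reflexive (∑-zero λ j → 𝟙-false (Q? j y) λ ((j∈J , p∈b) , y∈b) →
                                x∉ j j∈J (subst (λ b → x ∈ block b)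
                                  (joined-unique (x∉⁅y⁆⇒x≢y y∉⁅p⁆) (x∉∁p⇒x∈p y∉∁L) p∈L y∈b p∈b) x∈L))

    ∣J∣≤∣U∣ : 2 ≤ q → k ≤ q ^ 2 → (U : Subset (q ^ 2)) → (∀ j → j ∈ J → block (i j) ⊆ U) → ∣ J ∣ ≤ ∣ U ∣
    ∣J∣≤∣U∣ 2≤q k≤q² U N⊆U with nonempty? (∁ U)
    ... | no ∁U-empty = begin
      ∣ J ∣          ≤⟨ ∣p∣≤n J ⟩
      k              ≤⟨ k≤q² ⟩
      q ^ 2          ≡⟨ ∣⊤∣≡n (q ^ 2) ⟨
      ∣ ⊤ {q ^ 2} ∣  ≤⟨ p⊆q⇒∣p∣≤∣q∣ {p = ⊤} (λ {x} _ → x∉∁p⇒x∈p (∁U-empty ∘ (x ,_))) ⟩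
      ∣ U ∣          ∎
      where open ≤-Reasoning
    ... | yes (x , x∈∁U) = *-cancelʳ-≤ ∣ J ∣ ∣ U ∣ q {{>-nonZero (<⇒≤ 2≤q)}} (begin
      ∣ J ∣ * q                              ≡⟨ cong (_* q) (∣p∣≡∑𝟙 J) ⟩
      (∑[ j < k ] 𝟙 (j ∈? J)) * q            ≡⟨ doubleCount (_∈? J) (block ∘ i) (blockSize ∘ i) ⟩
      ∑[ p < q ^ 2 ] chosenThrough p         ≤⟨ ∑-mono bound ⟩
      ∑[ p < q ^ 2 ] (𝟙 (p ∈? U) * q)        ≡⟨ *-distribʳ-sum q (λ p → 𝟙 (p ∈? U)) ⟨
      (∑[ p < q ^ 2 ] 𝟙 (p ∈? U)) * q        ≡⟨ cong (_* q) (∣p∣≡∑𝟙 U) ⟨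
      ∣ U ∣ * q                              ∎)
      where
      open ≤-Reasoning
      x∉U : x ∉ U
      x∉U = x∈∁p⇒x∉p x∈∁U
      -- Chosen blocks lie in `U`, so they miss `x` and every `p` outside `U`; for `p ∈ U`,
      -- `chosenThrough≤q` applies.
      bound : ∀ p → chosenThrough p ≤ 𝟙 (p ∈? U) * q
      bound p with p ∈? U
      ... | yes p∈U = ≤-trans (chosenThrough≤q 2≤q (λ { refl → x∉U p∈U }) λ j j∈J x∈b → x∉U (N⊆U j j∈J x∈b))
                              (≤-reflexive (sym (*-identityˡ q)))
      ... | no  p∉U = ≤-reflexive (∑-zero λ j → 𝟙-false (j ∈? J ×-dec p ∈? block (i j))
                        λ (j∈J , p∈b) → p∉U (N⊆U j j∈J p∈b))

  affineCode-retrievable : 2 ≤ q → ∀ {k} → k ≤ q ^ 2 → Retrievable k (affineCode A)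
  affineCode-retrievable 2≤q k≤q² i i-inj = hall-SDR (block ∘ i) λ J → ∣J∣≤∣U∣ i-inj J 2≤q k≤q²

-- The upper bound

-- Otherwise `m` items avoiding `x` would be read from `m` distinct servers other than `x`. Removing
-- `x` with `punchOut` would inject `Fin (suc k)` into `Fin k`.
avoiding<m : (𝒞 : Placement m) → Retrievable m 𝒞 → ∀ x → ∑[ j < items 𝒞 ] 𝟙 (x ∈? ∁ (store 𝒞 j)) ≤ m ∸ 1
avoiding<m {suc k} 𝒞 retrieval x = ≮⇒≥ λ k<∑ →
  let i , i-inj , x∈∁ = select (λ j → x ∈? ∁ (store 𝒞 j)) k<∑
      s , s-inj , s∈  = retrieval i i-inj
      x≢s             = λ j (x≡s : x ≡ s j) → x∈∁p⇒x∉p (x∈∁ j) (subst (_∈ store 𝒞 (i j)) (sym x≡s) (s∈ j))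
  in n≮n k (injective⇒≤ λ {a} {b} eq → s-inj (punchOut-injective (x≢s a) (x≢s b) eq))

-- For `c < m` this is the binomial bound with `k = m`, since `(m C c) / ((m ∸ 1) C c)` equals
-- `m / (m ∸ c)`.
items*[m∸c]≤m*[m∸1] : ∀ {c} (𝒞 : Placement m) → Uniform c 𝒞 → Retrievable m 𝒞 →
  items 𝒞 * (m ∸ c) ≤ m * (m ∸ 1)
items*[m∸c]≤m*[m∸1] {m} {c} 𝒞 uniform retrieval = begin
  items 𝒞 * (m ∸ c)                                       ≡⟨ ∑-const (items 𝒞) (m ∸ c) ⟨
  ∑[ j < items 𝒞 ] (m ∸ c)                                ≡⟨ sum-cong-≗ (λ j → trans (∣∁p∣≡n∸∣p∣ (store 𝒞 j)) (cong (m ∸_) (uniform j))) ⟨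
  ∑[ j < items 𝒞 ] ∣ ∁ (store 𝒞 j) ∣                      ≡⟨ sum-cong-≗ (λ j → ∣p∣≡∑𝟙 (∁ (store 𝒞 j))) ⟩
  ∑[ j < items 𝒞 ] ∑[ x < m ] 𝟙 (x ∈? ∁ (store 𝒞 j))      ≡⟨ ∑-comm (λ j x → 𝟙 (x ∈? ∁ (store 𝒞 j))) ⟩
  ∑[ x < m ] ∑[ j < items 𝒞 ] 𝟙 (x ∈? ∁ (store 𝒞 j))      ≤⟨ ∑-mono (avoiding<m 𝒞 retrieval) ⟩
  ∑[ x < m ] (m ∸ 1)                                      ≡⟨ ∑-const m (m ∸ 1) ⟩
  m * (m ∸ 1)                                             ∎
  where open ≤-Reasoning

-- Binomial coefficients and equality in the bound

nCk*[k!*[n∸k]!]≡n! : ∀ {n k} → k ≤ n → (n C k) * (k ! * (n ∸ k) !) ≡ n !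
nCk*[k!*[n∸k]!]≡n! {n} {k} k≤n =
  trans (cong (_* (k ! * (n ∸ k) !)) (nCk≡n!/k![n-k]! k≤n))
        (m/n*n≡m {{k !* (n ∸ k) !≢0}} (k![n∸k]!∣n! k≤n))

-- Multiplied by `k ! * (n ∸ k) !`, both sides become `suc n * n !`.
[1+n∸k]*[1+n]Ck≡[1+n]*nCk : ∀ {n k} → k ≤ n → (suc n ∸ k) * (suc n C k) ≡ suc n * (n C k)
[1+n∸k]*[1+n]Ck≡[1+n]*nCk {n} {k} k≤n = *-cancelʳ-≡ _ _ (k ! * (n ∸ k) !) {{k !* (n ∸ k) !≢0}} (begin
  (suc n ∸ k) * (suc n C k) * (k ! * (n ∸ k) !)    ≡⟨ rearrange (suc n ∸ k) (suc n C k) (k !) ((n ∸ k) !) ⟩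
  (suc n C k) * (k ! * ((suc n ∸ k) * (n ∸ k) !))  ≡⟨ cong (λ t → (suc n C k) * (k ! * t)) ([n-k]*[n-k-1]!≡[n-k]! (s≤s k≤n)) ⟩
  (suc n C k) * (k ! * (suc n ∸ k) !)              ≡⟨ nCk*[k!*[n∸k]!]≡n! (m≤n⇒m≤1+n k≤n) ⟩
  suc n * n !                                      ≡⟨ cong (suc n *_) (nCk*[k!*[n∸k]!]≡n! k≤n) ⟨
  suc n * ((n C k) * (k ! * (n ∸ k) !))            ≡⟨ *-assoc (suc n) (n C k) _ ⟨
  suc n * (n C k) * (k ! * (n ∸ k) !)              ∎)
  where
  open ≡-Reasoning
  rearrange : ∀ a b c d → a * b * (c * d) ≡ b * (c * (a * d))
  rearrange = solve-∀

-- n = q² + q solves n (m − c) = m (m − 1) for m = q²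
-- and c = q.
[q²+q][q²∸q]≡q²[q²∸1] : ∀ q → (q ^ 2 + q) * (q ^ 2 ∸ q) ≡ q ^ 2 * (q ^ 2 ∸ 1)
[q²+q][q²∸q]≡q²[q²∸1] zero      = refl
[q²+q][q²∸q]≡q²[q²∸1] q@(suc r) = begin
  (q ^ 2 + q) * (q ^ 2 ∸ q)              ≡⟨ cong (λ t → (q ^ 2 + q) * (t ∸ q)) (q²≡ r) ⟩
  (q ^ 2 + q) * (q * r + q ∸ q)          ≡⟨ cong ((q ^ 2 + q) *_) (m+n∸n≡m (q * r) q) ⟩
  (q ^ 2 + q) * (q * r)                  ≡⟨ factor r ⟩
  q ^ 2 * (r * (2 + r))                  ≡⟨ cong (q ^ 2 *_) (m+n∸n≡m (r * (2 + r)) 1) ⟨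
  q ^ 2 * (r * (2 + r) + 1 ∸ 1)          ≡⟨ cong (λ t → q ^ 2 * (t ∸ 1)) (q²≡′ r) ⟨
  q ^ 2 * (q ^ 2 ∸ 1)                    ∎
  where
  open ≡-Reasoning
  q²≡ : ∀ r → suc r * (suc r * 1) ≡ suc r * r + suc r
  q²≡ = solve-∀
  q²≡′ : ∀ r → suc r * (suc r * 1) ≡ r * (2 + r) + 1
  q²≡′ = solve-∀
  factor : ∀ r → (suc r * (suc r * 1) + suc r) * (suc r * r) ≡ suc r * (suc r * 1) * (r * (2 + r))
  factor = solve-∀

-- The cross-multiplied equality with `upperBound`. After multiplication by the positive
-- `q ^ 2 ∸ q`, `absorb` removes the binomial coefficient `q ^ 2 C q` and leaves the polynomial
-- identity above.
[q²+q]*[q²∸1]Cq≡[q²∸1]*q²Cq : ∀ {q} → q < q ^ 2 →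
  (q ^ 2 + q) * ((q ^ 2 ∸ 1) C q) ≡ (q ^ 2 ∸ 1) * (q ^ 2 C q)
[q²+q]*[q²∸1]Cq≡[q²∸1]*q²Cq {q} q<q² = *-cancelˡ-≡ _ _ (q ^ 2 ∸ q) {{>-nonZero (m<n⇒0<n∸m q<q²)}} (begin
  d * (N * a)              ≡⟨ rearrange d N a ⟩
  N * d * a                ≡⟨ cong (_* a) ([q²+q][q²∸q]≡q²[q²∸1] q) ⟩
  q ^ 2 * (q ^ 2 ∸ 1) * a  ≡⟨ rearrange′ (q ^ 2) (q ^ 2 ∸ 1) a ⟩
  (q ^ 2 ∸ 1) * (q ^ 2 * a)  ≡⟨ cong ((q ^ 2 ∸ 1) *_) (absorb q<q²) ⟨
  (q ^ 2 ∸ 1) * (d * b)    ≡⟨ rearrange″ (q ^ 2 ∸ 1) d b ⟩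
  d * ((q ^ 2 ∸ 1) * b)    ∎)
  where
  open ≡-Reasoning
  N d a b : ℕ
  N = q ^ 2 + q
  d = q ^ 2 ∸ q
  a = (q ^ 2 ∸ 1) C q
  b = q ^ 2 C q
  absorb : ∀ {k m} → k < m → (m ∸ k) * (m C k) ≡ m * ((m ∸ 1) C k)
  absorb (s≤s k≤m) = [1+n∸k]*[1+n]Ck≡[1+n]*nCk k≤m
  rearrange : ∀ d n a → d * (n * a) ≡ n * d * a
  rearrange = solve-∀
  rearrange′ : ∀ m k a → m * k * a ≡ k * (m * a)
  rearrange′ = solve-∀
  rearrange″ : ∀ k d b → k * (d * b) ≡ d * (k * b)
  rearrange″ = solve-∀

-- Opened only here: in scope of the prefix +_, sums of cardinalities ∣_∣ do not parse.
open import Data.Integer using (+_)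

-- Equality of unnormalised fractions is cross-multiplication, and normalisation respects it. `mkℚᵘ`
-- stores the denominator minus one, hence `0` and `d-1`.
m*d≡n⇒m/1≡n/d : ∀ m n d .{{_ : NonZero d}} → m * d ≡ n → + m / 1 ≡ + n / d
m*d≡n⇒m/1≡n/d m n d@(suc d-1) m*d≡n = fromℚᵘ-cong {mkℚᵘ (+ m) 0} {mkℚᵘ (+ n) d-1}
  (*≡* (trans (sym (pos-* m d)) (trans (cong +_ (trans m*d≡n (sym (*-identityʳ n)))) (pos-* n 1))))

theorem17 : (q : ℕ) (3≤q : 3 ≤ q) → PrimePower q → (A : AffinePlane q) →
    (IsCBC (q ^ 2 + q) (q ^ 3 + q ^ 2) (q ^ 2) (q ^ 2) (affineCode A) × Uniform q (affineCode A))
    × Optimal q (q ^ 2) (affineCode A)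
    × IsMaxItems (q ^ 2) q (q ^ 2) (q ^ 2 + q)
    × + (q ^ 2 + q) / 1 ≡ upperBound (q ^ 2) q (q ^ 2) (3≤q⇒q≤q²-1 3≤q)
theorem17 q 3≤q _ A =
  (subst (λ N → IsCBC M N (q ^ 2) (q ^ 2) 𝒞) (q*M q) isCBC , uniform) ,
  subst (λ n → UniformCBC q n (q ^ 2) (q ^ 2) 𝒞 × IsMaxItems (q ^ 2) q (q ^ 2) n) (sym items≡M)
    ((isCBC , uniform) , isMax) ,
  isMax ,
  m*d≡n⇒m/1≡n/d M _ _ {{>-nonZero (nCk>0 (3≤q⇒q≤q²-1 3≤q))}} ([q²+q]*[q²∸1]Cq≡[q²∸1]*q²Cq q<q²)
  where
  M : ℕ
  M = q ^ 2 + q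
  𝒞 : Placement (q ^ 2)
  𝒞 = affineCode A
  q*M : ∀ q → q * (q * (q * 1) + q) ≡ q * (q * (q * 1)) + q * (q * 1)
  q*M = solve-∀
  items≡ : ∀ q → q * (q + 1) ≡ q * (q * 1) + q
  items≡ = solve-∀
  items≡M : q * (q + 1) ≡ M
  items≡M = items≡ q
  uniform : Uniform q 𝒞
  uniform = AffinePlane.blockSize A
  q<q² : q < q ^ 2
  q<q² = ≤-trans (s≤s (3≤q⇒q≤q²-1 3≤q))
    (≤-reflexive (m+[n∸m]≡n {1} (m^n>0 q {{>-nonZero (≤-trans (s≤s z≤n) 3≤q)}} 2)))
  isCBC : IsCBC M (q * M) (q ^ 2) (q ^ 2) 𝒞
  isCBC = record
    { numItems  = items≡M
    ; storage   = trans (sum-cong-≗ uniform) (trans (∑-const (q * (q + 1)) q)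
                    (trans (*-comm _ q) (cong (q *_) items≡M)))
    ; retrieval = affineCode-retrievable A (<⇒≤ 3≤q) ≤-refl
    }
  isMax : IsMaxItems (q ^ 2) q (q ^ 2) M
  isMax = (𝒞 , isCBC , uniform) , λ n′ (𝒞′ , cbc , uniform′) →
    -- `M` attains equality in the counting bound that every competitor obeys, so the common
    -- positive factor cancels.
    *-cancelʳ-≤ n′ M (q ^ 2 ∸ q) {{>-nonZero (m<n⇒0<n∸m q<q²)}}
      (subst₂ _≤_ (cong (_* (q ^ 2 ∸ q)) (IsCBC.numItems cbc)) (sym ([q²+q][q²∸q]≡q²[q²∸1] q))
        (items*[m∸c]≤m*[m∸1] 𝒞′ uniform′ (IsCBC.retrieval cbc)))
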